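{- Let $q$ be an odd prime power, $t\ge3$ an integer, $W=\{x\in\mathbb{F}_{q^{2t}} : x^{q^t}+x=0\}$, and $\sigma=q^J$ with $J\in\{1,\ldots,2t-1\}$, $\gcd(J,2t)=1$. If $m\in\mathbb{F}_{q^t}$ is neither a $(q-1)$-th power nor a $(q+1)$-th power of any element of $W$, then the $q$-polynomial \[\varphi_{m,\sigma}=X^{\sigma^{t-1}}+X^{\sigma^{2t-1}}+m\left(X^{\sigma}-X^{\sigma^{t+1}}\right)\in\mathbb{F}_{q^{2t}}[X]\] is scattered.
   Context: $q$-polynomials over $\mathbb{F}_{q^{2t}}$ are considered modulo $X^{q^{2t}}-X$ and identified with the corresponding $\mathbb{F}_q$-linear maps. A $q$-polynomial $f$ over $\mathbb{F}_{q^{2t}}$ is scattered if for all $x,y\in\mathbb{F}_{q^{2t}}^*$, $f(x)/x=f(y)/y$ implies $x/y\in\mathbb{F}_q$. -}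

module Defs where

open import Level using (0ℓ)
open import Data.Nat as ℕ using (ℕ; zero; suc)
open import Data.Fin using (Fin)
open import Data.Product using (Σ; _×_; ∃-syntax)
open import Relation.Nullary using (¬_)
open import Algebra.Bundles using (CommutativeRing)
open import Function.Bundles using (Bijection)
import Relation.Binary.PropositionalEquality as P

record FiniteField (N : ℕ) : Set₁ where
  field
    commRing : CommutativeRing 0ℓ 0ℓ
  open CommutativeRing commRing public
  field
    _⁻¹      : Carrier → Carrier
    1≉0      : ¬ (1# ≈ 0#)
    inverseʳ : ∀ x → ¬ (x ≈ 0#) → (x * (x ⁻¹)) ≈ 1#
    card     : Bijection setoid (P.setoid (Fin N))

  infixr 8 _^_
  _^_ : Carrier → ℕ → Carrier
  x ^ zero  = 1#
  x ^ suc n = x * (x ^ n)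

module _ {N : ℕ} (F : FiniteField N) where
  open FiniteField F

  -- a q-polynomial f : F → F is scattered: for nonzero x, y,
  -- f(x)/x = f(y)/y implies x/y ∈ F_q, where F_q = {z | z^q = z}.
  Scattered : (q : ℕ) → (Carrier → Carrier) → Set
  Scattered q f = ∀ x y → ¬ (x ≈ 0#) → ¬ (y ≈ 0#) →
    (f x * (x ⁻¹)) ≈ (f y * (y ⁻¹)) →
    ((x * (y ⁻¹)) ^ q) ≈ (x * (y ⁻¹))

  InW : (q t : ℕ) → Carrier → Set
  InW q t x = ((x ^ (q ℕ.^ t)) + x) ≈ 0#

  PowerFromW : (q t k : ℕ) → Carrier → Set
  PowerFromW q t k m = ∃[ w ] (InW q t w × ((w ^ k) ≈ m))

  φ : (σ t : ℕ) → Carrier → Carrier → Carrier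
  φ σ t m x = ((x ^ (σ ℕ.^ (t ℕ.∸ 1))) + (x ^ (σ ℕ.^ (2 ℕ.* t ℕ.∸ 1))))
              + (m * ((x ^ σ) - (x ^ (σ ℕ.^ (t ℕ.+ 1)))))

OddPrimePower : ℕ → Set
OddPrimePower q = Σ ℕ λ p → Σ ℕ λ k →
  (Data.Nat.Primality.Prime p) × ¬ (p P.≡ 2) × (1 ℕ.≤ k) × (q P.≡ p ℕ.^ k)
  where import Data.Nat.Primality

{-# OPTIONS --safe #-}

-- Write S x = x ^ σ and B x = x ^ (q ^ t), so that W is the set of skew elements, B x = - x.
-- With P x = x ^ (σ ^ (t - 1)), the elements a = P x + B (P x) and b = x - B x are symmetric and skew,
-- 2 x = S a + b and φ x = a + m * S b. Let c and d be the analogous elements for y. The symmetric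
-- and skew parts of φ x * y = φ y * x are
--   a * S c - c * S a = m * (b * S d - d * S b)   and   a * d - c * b = m * S (a * d - c * b).
-- If z = a * d - c * b is nonzero, then m = (1 / z) ^ (σ - 1). Otherwise (b , d) = r * (a , c) with r skew,
-- and the first equation gives m = (1 / r) ^ (σ + 1) unless a / c is fixed by S, in which
-- case x / y = a / c. Since (σ - 1) / (q - 1) and (σ + 1) / (q + 1) are odd and odd powers of
-- skew elements are skew, the first two cases are excluded.

module Submission where

open import Defs
open import Level using (0ℓ)
open import Algebra.Bundles using (CommutativeMonoid)
open import Algebra.Morphism.Structures using (IsRingHomomorphism)
import Algebra.Properties.CommutativeMonoid.Sum as Sum
import Algebra.Properties.CommutativeSemiring.Binomial
import Algebra.Properties.CommutativeSemiring.Exp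
import Algebra.Properties.Ring
import Algebra.Properties.Semiring.Mult
import Algebra.Solver.Ring.NaturalCoefficients.Default
open import Data.Fin as Fin using (Fin)
import Data.Fin.Properties as Fin
open import Data.Fin.Permutation using (permutation)
open import Data.Nat as ℕ using (ℕ; zero; suc; z≤n; s≤s)
import Data.Nat.Properties as ℕ
open import Data.Nat.Combinatorics using (_C_; nCn≡1; nCk≡n!/k![n-k]!; k![n∸k]!∣n!)
open import Data.Nat.Divisibility using (_∣_; _∤_; divides; ∣⇒≤; m∣m*n; ∣1⇒≡1)
open import Data.Nat.DivMod using (m*[n/m]≡n)
open import Data.Nat.GCD using (gcd; gcd-greatest; gcd-GCD; GCD; module Bézout)
open import Data.Nat.Primality using (Prime; euclidsLemma; prime⇒irreducible; prime⇒nonZero; ¬prime[0]; ¬prime[1])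
open import Data.Nat.Solver using (module +-*-Solver)
open import Data.Product using (∃-syntax; _×_; _,_; proj₁; proj₂)
open import Data.Sum using (_⊎_; inj₁; inj₂)
open import Data.Vec.Functional using (Vector)
open import Function using (_∘_; const; Congruent; Inverse)
open import Function.Bundles using (Bijection)
open import Function.Properties.Bijection using (Bijection⇒Inverse)
open import Relation.Nullary using (¬_; contradiction; Dec; yes; no)
open import Relation.Nullary.Decidable using (map′)
import Relation.Binary.Reasoning.Setoid
open import Relation.Binary.PropositionalEquality as P using (_≡_)

-- Parity, odd quotients of powers, and divisibility of binomial coefficients.

module Arithmetic where
  open import Data.Nat using (_^_; _*_; _∸_; _<_; _+_; _!)
  open import Data.Nat.Properties
  open P using (_≢_; refl; sym; trans; cong; subst; module ≡-Reasoning)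

  Odd : ℕ → Set
  Odd n = ∃[ s ] n ≡ 1 + 2 * s

  even⊎odd : ∀ n → (∃[ s ] n ≡ 2 * s) ⊎ Odd n
  even⊎odd zero = inj₁ (0 , refl)
  even⊎odd (suc n) with even⊎odd n
  ... | inj₁ (s , n≡2s)   = inj₂ (s , cong suc n≡2s)
  ... | inj₂ (s , n≡1+2s) = inj₁ (suc s , trans (cong suc n≡1+2s) (sym (*-suc 2 s)))

  ¬2∣⇒odd : ∀ {n} → 2 ∤ n → Odd n
  ¬2∣⇒odd {n} 2∤n with even⊎odd n
  ... | inj₁ (s , eq) = contradiction (divides s (trans eq (*-comm 2 s))) 2∤n
  ... | inj₂ odd      = odd

  odd-* : ∀ {m n} → Odd m → Odd n → Odd (m * n)
  odd-* (r , refl) (s , refl) = r + s + 2 * (r * s) ,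
    solve 2 (λ r s → (con 1 :+ con 2 :* r) :* (con 1 :+ con 2 :* s)
                  := con 1 :+ con 2 :* (r :+ s :+ con 2 :* (r :* s))) refl r s
    where open +-*-Solver

  odd-^ : ∀ {n} → Odd n → ∀ k → Odd (n ^ k)
  odd-^ odd zero    = 0 , refl
  odd-^ odd (suc k) = odd-* odd (odd-^ odd k)

  oddPrime⇒odd : ∀ {p} → Prime p → p ≢ 2 → Odd p
  oddPrime⇒odd {p} p-prime p≢2 = ¬2∣⇒odd 2∤p
    where
    2∤p : 2 ∤ p
    2∤p 2∣p with prime⇒irreducible p-prime 2∣p
    ... | inj₂ 2≡p = p≢2 (sym 2≡p)

  oddPrimePower⇒odd : ∀ {q} → OddPrimePower q → Odd q
  oddPrimePower⇒odd (p , k , p-prime , p≢2 , _ , refl) = odd-^ (oddPrime⇒odd p-prime p≢2) k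

  coprime-even⇒odd : ∀ {m} n → gcd m (2 * n) ≡ 1 → Odd m
  coprime-even⇒odd n gcd≡1 = ¬2∣⇒odd λ 2∣m →
    contradiction (∣1⇒≡1 (subst (2 ∣_) gcd≡1 (gcd-greatest 2∣m (m∣m*n n)))) λ ()

  -- k = 1 + q + ... + q ^ (n - 1)
  odd-quotient-minus : ∀ {q n} → Odd q → Odd n → ∃[ k ] Odd k × q ^ n ≡ 1 + k * (q ∸ 1)
  odd-quotient-minus (s , refl) (zero , refl) = 1 , (0 , refl) ,
    solve 1 (λ s → (con 1 :+ con 2 :* s) :* con 1 := con 1 :+ con 1 :* (con 2 :* s)) refl s
    where open +-*-Solver
  odd-quotient-minus (s , refl) (suc i , refl) with odd-quotient-minus (s , refl) (i , refl)
  -- If `k` is the quotient for `n`, the quotient for `n + 2` is `1 + q + q * q * k`; the witness is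
  -- half of its predecessor.
  ... | _ , (j , refl) , eq = _ , (1 + s + 2 * s + 2 * s * s + j * (1 + 2 * s) * (1 + 2 * s) , refl) , (begin
    q ^ (1 + 2 * suc i)  ≡⟨ cong (λ e → q ^ suc e) (*-suc 2 i) ⟩
    q * (q * q ^ (1 + 2 * i))  ≡⟨ cong (λ z → q * (q * z)) eq ⟩
    q * (q * (1 + (1 + 2 * j) * (2 * s)))
      ≡⟨ solve 2 (λ s j → let q = con 1 :+ con 2 :* s in
           q :* (q :* (con 1 :+ (con 1 :+ con 2 :* j) :* (con 2 :* s)))
           := con 1 :+ (con 1 :+ con 2 :* (con 1 :+ s :+ con 2 :* s :+ con 2 :* s :* s :+ j :* q :* q)) :* (con 2 :* s))
         refl s j ⟩
    _ ∎)
    where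
    open ≡-Reasoning
    open +-*-Solver
    q = 1 + 2 * s

  -- k = 1 - q + ... + q ^ (n - 1)
  odd-quotient-plus : ∀ {q n} → Odd q → Odd n → ∃[ k ] Odd k × 1 + q ^ n ≡ k * (q + 1)
  odd-quotient-plus (s , refl) (zero , refl) = 1 , (0 , refl) ,
    solve 1 (λ s → con 1 :+ (con 1 :+ con 2 :* s) :* con 1 := con 1 :* (con 1 :+ con 2 :* s :+ con 1)) refl s
    where open +-*-Solver
  odd-quotient-plus (s , refl) (suc i , refl) with odd-quotient-plus (s , refl) (i , refl)
  -- The next quotient is `1 - q + q * q * k`, and the witness is half of its predecessor. Adding
  -- `q * q` to both sides keeps the calculation free of subtraction.
  ... | _ , (j , refl) , eq = _ , (s * (1 + 2 * s) + j * (1 + 2 * s) * (1 + 2 * s) , refl) ,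
    +-cancelʳ-≡ (q * q) _ _ (begin
    1 + q ^ (1 + 2 * suc i) + q * q  ≡⟨ cong (λ e → 1 + q ^ suc e + q * q) (*-suc 2 i) ⟩
    1 + q * (q * q ^ (1 + 2 * i)) + q * q
      ≡⟨ solve 2 (λ q z → con 1 :+ q :* (q :* z) :+ q :* q := con 1 :+ q :* (q :* (con 1 :+ z))) refl q (q ^ (1 + 2 * i)) ⟩
    1 + q * (q * (1 + q ^ (1 + 2 * i)))  ≡⟨ cong (λ z → 1 + q * (q * z)) eq ⟩
    1 + q * (q * ((1 + 2 * j) * (q + 1)))
      ≡⟨ solve 2 (λ s j → let q = con 1 :+ con 2 :* s in
           con 1 :+ q :* (q :* ((con 1 :+ con 2 :* j) :* (q :+ con 1)))
           := (con 1 :+ con 2 :* (s :* q :+ j :* q :* q)) :* (q :+ con 1) :+ q :* q)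
         refl s j ⟩
    _ ∎)
    where
    open ≡-Reasoning
    open +-*-Solver
    q = 1 + 2 * s

  -- By Euclid's lemma `p` would divide one of the factors, all of which are positive and smaller
  -- than `p`.
  prime∤! : ∀ {p} → Prime p → ∀ k → k < p → p ∤ k !
  prime∤! p-prime zero    _   p∣1 = ¬prime[1] (subst Prime (∣1⇒≡1 p∣1) p-prime)
  prime∤! p-prime (suc k) k<p p∣! with euclidsLemma (suc k) (k !) p-prime p∣!
  ... | inj₁ p∣1+k = <⇒≱ k<p (∣⇒≤ p∣1+k)
  ... | inj₂ p∣k!  = prime∤! p-prime k (<-trans (n<1+n k) k<p) p∣k!

  -- The product of `k !`, `(p - k) !` and the binomial coefficient is `p !`, which `p` divides; it
  -- divides neither factorial, since `k` and `p - k` are below `p`.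
  prime∣C : ∀ {p} → Prime p → ∀ {k} → 0 < k → k < p → p ∣ p C k
  prime∣C {zero}    p-prime _ _ = contradiction p-prime ¬prime[0]
  prime∣C {p@(suc n)} p-prime {k} 0<k k<p
    with euclidsLemma (k ! * (p ∸ k) !) (p C k) p-prime (subst (p ∣_) (sym p!≡) (m∣m*n (n !)))
    where
    instance _ = k !* (p ∸ k) !≢0
    p!≡ : k ! * (p ∸ k) ! * (p C k) ≡ p !
    p!≡ = trans (cong (k ! * (p ∸ k) ! *_) (nCk≡n!/k![n-k]! (<⇒≤ k<p)))
                (m*[n/m]≡n (k![n∸k]!∣n! (<⇒≤ k<p)))
  ... | inj₂ p∣C = p∣C
  ... | inj₁ p∣k![p-k]! with euclidsLemma (k !) ((p ∸ k) !) p-prime p∣k![p-k]!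
  ...   | inj₁ p∣k!     = contradiction p∣k! (prime∤! p-prime k k<p)
  ...   | inj₂ p∣[p-k]! = contradiction p∣[p-k]! (prime∤! p-prime (p ∸ k) (∸-monoʳ-< 0<k (<⇒≤ k<p)))

open Arithmetic

-- Inverses and powers in a finite field.

module FieldProperties {N : ℕ} (F : FiniteField N) where
  open FiniteField F
  open Algebra.Properties.Ring ring
  open Relation.Binary.Reasoning.Setoid setoid
  open Algebra.Properties.Semiring.Mult semiring
    using (×-homo-1; ×-assoc-*; ×1-homo-*; ×-congʳ) renaming (_×_ to _·_)
  open Algebra.Solver.Ring.NaturalCoefficients.Default commutativeSemiring
  module Exp = Algebra.Properties.CommutativeSemiring.Exp commutativeSemiring
  module Enum = Inverse (Bijection⇒Inverse card)

  infix 4 _≟_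
  _≟_ : ∀ x y → Dec (x ≈ y)
  x ≟ y = map′ (Bijection.injective card) Enum.to-cong (Enum.to x Fin.≟ Enum.to y)

  inverseˡ : ∀ {x} → x ≉ 0# → x ⁻¹ * x ≈ 1#
  inverseˡ {x} x≉0 = trans (*-comm (x ⁻¹) x) (inverseʳ x x≉0)

  x⁻¹[xy]≈y : ∀ {x} y → x ≉ 0# → x ⁻¹ * (x * y) ≈ y
  x⁻¹[xy]≈y {x} y x≉0 = begin
    x ⁻¹ * (x * y)  ≈⟨ *-assoc _ _ _ ⟨
    x ⁻¹ * x * y    ≈⟨ *-congʳ (inverseˡ x≉0) ⟩
    1# * y          ≈⟨ *-identityˡ y ⟩
    y               ∎

  x[x⁻¹y]≈y : ∀ {x} y → x ≉ 0# → x * (x ⁻¹ * y) ≈ y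
  x[x⁻¹y]≈y {x} y x≉0 = begin
    x * (x ⁻¹ * y)  ≈⟨ *-assoc _ _ _ ⟨
    x * x ⁻¹ * y    ≈⟨ *-congʳ (inverseʳ x x≉0) ⟩
    1# * y          ≈⟨ *-identityˡ y ⟩
    y               ∎

  *-cancelˡ : ∀ {x y z} → x ≉ 0# → x * y ≈ x * z → y ≈ z
  *-cancelˡ {x} {y} {z} x≉0 xy≈xz = begin
    y               ≈⟨ x⁻¹[xy]≈y y x≉0 ⟨
    x ⁻¹ * (x * y)  ≈⟨ *-congˡ xy≈xz ⟩
    x ⁻¹ * (x * z)  ≈⟨ x⁻¹[xy]≈y z x≉0 ⟩
    z               ∎

  x≉0∧xy≈0⇒y≈0 : ∀ {x y} → x ≉ 0# → x * y ≈ 0# → y ≈ 0#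
  x≉0∧xy≈0⇒y≈0 x≉0 xy≈0 = *-cancelˡ x≉0 (trans xy≈0 (sym (zeroʳ _)))

  -- Carries the library's laws of exponents over to the power operation of `FiniteField`.
  ^-≡ : ∀ x n → x ^ n ≡ x Exp.^ n
  ^-≡ x zero    = P.refl
  ^-≡ x (suc n) = P.cong (x *_) (^-≡ x n)

  ^-congˡ : ∀ n {x y} → x ≈ y → x ^ n ≈ y ^ n
  ^-congˡ n {x} {y} rewrite ^-≡ x n | ^-≡ y n = Exp.^-congˡ n

  ^-assocʳ : ∀ x m n → (x ^ m) ^ n ≈ x ^ (m ℕ.* n)
  ^-assocʳ x m n rewrite ^-≡ (x ^ m) n | ^-≡ x (m ℕ.* n) | ^-≡ x m = Exp.^-assocʳ x m n

  ^-distrib-* : ∀ x y n → (x * y) ^ n ≈ x ^ n * y ^ n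
  ^-distrib-* x y n rewrite ^-≡ (x * y) n | ^-≡ x n | ^-≡ y n = Exp.^-distrib-* x y n

  1^n≈1 : ∀ n → 1# ^ n ≈ 1#
  1^n≈1 zero    = refl
  1^n≈1 (suc n) = trans (*-identityˡ _) (1^n≈1 n)

  x^n≈0⇒x≈0 : ∀ x n → x ^ n ≈ 0# → x ≈ 0#
  x^n≈0⇒x≈0 x zero    1≈0  = contradiction 1≈0 1≉0
  x^n≈0⇒x≈0 x (suc n) x*x^n≈0 with x ≟ 0#
  ... | yes x≈0 = x≈0
  ... | no  x≉0 = x^n≈0⇒x≈0 x n (x≉0∧xy≈0⇒y≈0 x≉0 x*x^n≈0)

  -- Sums and products over all elements of the field.

  module _ (M : CommutativeMonoid 0ℓ 0ℓ) where
    private module M = CommutativeMonoid M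
    open Sum M using (sum; sum-permute; sum-cong-≋; sum-remove; sum-replicate-zero)

    -- Conjugating `h` by the enumeration gives a permutation of the indices. The monoid is
    -- arbitrary because both products and sums over the field get reindexed.
    sum-bijection : ∀ {f : Carrier → M.Carrier} → Congruent _≈_ M._≈_ f →
      (h g : Carrier → Carrier) → Congruent _≈_ _≈_ h → Congruent _≈_ _≈_ g →
      (∀ x → h (g x) ≈ x) → (∀ x → g (h x) ≈ x) →
      sum (f ∘ Enum.from) M.≈ sum (f ∘ h ∘ Enum.from)
    sum-bijection {f} f-cong h g h-cong g-cong hg gh = M.trans
      (sum-permute (f ∘ Enum.from) (permutation
        (Enum.to ∘ h ∘ Enum.from) (Enum.to ∘ g ∘ Enum.from)
        (conjugate-inverse h g h-cong hg) (conjugate-inverse g h g-cong gh)))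
      (sum-cong-≋ λ i → f-cong (Enum.strictlyInverseʳ (h (Enum.from i))))
      where
      conjugate-inverse : ∀ h g → Congruent _≈_ _≈_ h → (∀ x → h (g x) ≈ x) →
        ∀ i → Enum.to (h (Enum.from (Enum.to (g (Enum.from i))))) ≡ i
      conjugate-inverse h g h-cong hg i = P.trans
        (Enum.to-cong (trans (h-cong (Enum.strictlyInverseʳ _)) (hg _)))
        (Enum.strictlyInverseˡ i)

    sum-single : ∀ {n} (i : Fin n) (t : Vector M.Carrier n) →
      (∀ j → ¬ (j ≡ i) → t j M.≈ M.ε) → sum t M.≈ t i
    sum-single {suc n} i t t≈ε = M.trans (sum-remove t) (M.trans
      (M.∙-congˡ (M.trans (sum-cong-≋ λ j → t≈ε _ (Fin.punchInᵢ≢i i j)) (sum-replicate-zero n)))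
      (M.identityʳ _))

  open Sum *-commutativeMonoid using () renaming
    (sum to product; sum-cong-≋ to product-cong; sum-replicate to product-replicate; ∑-distrib-+ to product-distrib-*)
  open Sum +-commutativeMonoid using (sum; sum-replicate; sum-replicate-zero; sum-cong-≋; sum-init-last; ∑-distrib-+)

  product≉0 : ∀ {n} (t : Vector Carrier n) → (∀ i → t i ≉ 0#) → product t ≉ 0#
  product≉0 {zero}  t t≉0 = 1≉0
  product≉0 {suc n} t t≉0 = product≉0 (t ∘ Fin.suc) (t≉0 ∘ Fin.suc) ∘ x≉0∧xy≈0⇒y≈0 (t≉0 Fin.zero)

  ifZero_then_else_ : Carrier → Carrier → Carrier → Carrier
  ifZero x then y else z with x ≟ 0#
  ... | yes _ = y
  ... | no  _ = z

  ifZero-cong : ∀ {x x′ y y′ z z′} → x ≈ x′ → y ≈ y′ → z ≈ z′ →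
    ifZero x then y else z ≈ ifZero x′ then y′ else z′
  ifZero-cong {x} {x′} x≈x′ y≈y′ z≈z′ with x ≟ 0# | x′ ≟ 0#
  ... | yes _   | yes _    = y≈y′
  ... | no  _   | no  _    = z≈z′
  ... | yes x≈0 | no  x′≉0 = contradiction (trans (sym x≈x′) x≈0) x′≉0
  ... | no  x≉0 | yes x′≈0 = contradiction (trans x≈x′ x′≈0) x≉0

  -- Replacing zero by one lets a product indexed by the whole field run over the nonzero elements.
  nonzeroPart : Carrier → Carrier
  nonzeroPart x = ifZero x then 1# else x

  nonzeroPart≉0 : ∀ x → nonzeroPart x ≉ 0#
  nonzeroPart≉0 x with x ≟ 0#
  ... | yes _   = 1≉0
  ... | no  x≉0 = x≉0

  -- The correcting factor is `x` at `y = 0`, where `nonzeroPart` hides the multiplication by `x`,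
  -- and one elsewhere; so the identity can be multiplied over the whole field.
  nonzeroPart-* : ∀ {x} y → x ≉ 0# →
    nonzeroPart (x * y) * (ifZero y then x else 1#) ≈ x * nonzeroPart y
  nonzeroPart-* {x} y x≉0 with x * y ≟ 0# | y ≟ 0#
  ... | yes _    | yes _   = *-comm 1# x
  ... | no  _    | no  _   = *-identityʳ (x * y)
  ... | yes xy≈0 | no  y≉0 = contradiction (x≉0∧xy≈0⇒y≈0 x≉0 xy≈0) y≉0
  ... | no  xy≉0 | yes y≈0 = contradiction (trans (*-congˡ y≈0) (zeroʳ x)) xy≉0

  -- Multiplication by x permutes the nonzero elements, so comparing the products of all
  -- of them before and after gives x ^ (N - 1) = 1; the zero element accounts for the missing factor x.
  x^N≈x : ∀ x → x ^ N ≈ x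
  x^N≈x x with x ≟ 0#
  ... | yes x≈0 = begin
    x ^ N   ≈⟨ ^-congˡ N x≈0 ⟩
    0# ^ N  ≈⟨ 0^n≈0 (Enum.to 0#) ⟩
    0#      ≈⟨ x≈0 ⟨
    x       ∎
    where
    -- The element of `Fin n` witnesses that the exponent is positive.
    0^n≈0 : ∀ {n} → Fin n → 0# ^ n ≈ 0#
    0^n≈0 {suc n} _ = zeroˡ _
  ... | no  x≉0 = *-cancelˡ (product≉0 (nonzeroPart ∘ Enum.from) (nonzeroPart≉0 ∘ Enum.from)) (begin
    Π * x ^ N        ≡⟨ P.cong (Π *_) (^-≡ x N) ⟩
    Π * (x Exp.^ N)  ≈⟨ *-comm _ _ ⟩
    (x Exp.^ N) * Π  ≈⟨ *-congʳ (product-replicate N) ⟨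
    product {N} (const x) * Π  ≈⟨ product-distrib-* (const x) (nonzeroPart ∘ Enum.from) ⟨
    product (λ i → x * nonzeroPart (Enum.from i))
      ≈⟨ product-cong (λ i → nonzeroPart-* (Enum.from i) x≉0) ⟨
    product (λ i → nonzeroPart (x * Enum.from i) * atZero i)
      ≈⟨ product-distrib-* (λ i → nonzeroPart (x * Enum.from i)) atZero ⟩
    product (λ i → nonzeroPart (x * Enum.from i)) * product atZero
      ≈⟨ *-cong (sym (sum-bijection *-commutativeMonoid (λ y≈z → ifZero-cong y≈z refl y≈z)
                  (x *_) (x ⁻¹ *_) *-congˡ *-congˡ (λ y → x[x⁻¹y]≈y y x≉0) (λ y → x⁻¹[xy]≈y y x≉0)))
                product-atZero ⟩
    Π * x            ∎)
    where
    Π = product (nonzeroPart ∘ Enum.from)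

    atZero : Fin N → Carrier
    atZero i = ifZero Enum.from i then x else 1#

    atZero≈1 : ∀ i → ¬ (i ≡ Enum.to 0#) → atZero i ≈ 1#
    atZero≈1 i i≢ with Enum.from i ≟ 0#
    ... | no  _   = refl
    ... | yes i≈0 = contradiction (P.trans (P.sym (Enum.strictlyInverseˡ i)) (Enum.to-cong i≈0)) i≢

    atZero≈x : atZero (Enum.to 0#) ≈ x
    atZero≈x with Enum.from (Enum.to 0#) ≟ 0#
    ... | yes _  = refl
    ... | no  ≉0 = contradiction (Enum.strictlyInverseʳ 0#) ≉0

    product-atZero : product atZero ≈ x
    product-atZero = trans (sum-single *-commutativeMonoid (Enum.to 0#) atZero atZero≈1) atZero≈x

  -- Translation by 1 permutes the field, so it preserves the sum of all elements.
  N·1≈0 : N · 1# ≈ 0#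
  N·1≈0 = +-cancelʳ Σx _ _ (begin
    N · 1# + Σx                    ≈⟨ +-congʳ (sum-replicate N) ⟨
    sum {N} (const 1#) + Σx        ≈⟨ ∑-distrib-+ (const 1#) Enum.from ⟨
    sum (λ i → 1# + Enum.from i)   ≈⟨ sum-bijection +-commutativeMonoid (λ y≈z → y≈z) (1# +_) (- 1# +_) +-congˡ +-congˡ
                                        (\\-leftDividesˡ 1#) (\\-leftDividesʳ 1#) ⟨
    Σx                             ≈⟨ +-identityˡ Σx ⟨
    0# + Σx                        ∎)
    where Σx = sum Enum.from

  -- The characteristic and the Frobenius endomorphisms.

  ·1-homo-^ : ∀ m n → (m ℕ.^ n) · 1# ≈ (m · 1#) ^ n
  ·1-homo-^ m zero    = ×-homo-1 1#
  ·1-homo-^ m (suc n) = trans (×1-homo-* m (m ℕ.^ n)) (*-congˡ (·1-homo-^ m n))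

  -- The `n`-th power of `p · 1#` is `N · 1#`, which vanishes, and a field has no nonzero nilpotent
  -- elements.
  p·1≈0 : ∀ {p} n → N ≡ p ℕ.^ n → p · 1# ≈ 0#
  p·1≈0 {p} n N≡p^n = x^n≈0⇒x≈0 (p · 1#) n (begin
    (p · 1#) ^ n    ≈⟨ ·1-homo-^ p n ⟨
    (p ℕ.^ n) · 1#  ≡⟨ P.cong (_· 1#) N≡p^n ⟨
    N · 1#          ≈⟨ N·1≈0 ⟩
    0#              ∎)

  p∣n⇒n·x≈0 : ∀ {p} → p · 1# ≈ 0# → ∀ {n} x → p ∣ n → n · x ≈ 0#
  p∣n⇒n·x≈0 {p} p·1≈0 x (divides k P.refl) = begin
    (k ℕ.* p) · x                 ≈⟨ ×-congʳ (k ℕ.* p) (*-identityˡ x) ⟨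
    (k ℕ.* p) · (1# * x)          ≈⟨ ×-assoc-* (k ℕ.* p) 1# x ⟨
    ((k ℕ.* p) · 1#) * x          ≈⟨ *-congʳ (×1-homo-* k p) ⟩
    ((k · 1#) * (p · 1#)) * x     ≈⟨ *-congʳ (trans (*-congˡ p·1≈0) (zeroʳ _)) ⟩
    0# * x                        ≈⟨ zeroˡ x ⟩
    0#                            ∎

  -- In the binomial expansion only the two extreme terms survive: `p` divides every other
  -- coefficient.
  ^p-distrib-+ : ∀ {p} → Prime p → p · 1# ≈ 0# → ∀ x y → (x + y) ^ p ≈ x ^ p + y ^ p
  ^p-distrib-+ {zero}  p-prime = contradiction p-prime ¬prime[0]
  ^p-distrib-+ {suc n} p-prime p·1≈0 x y = begin
    (x + y) ^ suc n                                ≡⟨ ^-≡ (x + y) (suc n) ⟩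
    (x + y) Exp.^ suc n                            ≈⟨ Binomial.theorem (suc n) x y ⟩
    term Fin.zero + sum (term ∘ Fin.suc)           ≈⟨ +-cong first (sum-init-last (term ∘ Fin.suc)) ⟩
    y ^ suc n + (sum (λ i → term (Fin.suc (Fin.inject₁ i))) + term (Fin.fromℕ (suc n)))
      ≈⟨ +-congˡ (+-cong (trans (sum-cong-≋ middle) (sum-replicate-zero n)) last) ⟩
    y ^ suc n + (0# + x ^ suc n)                   ≈⟨ +-congˡ (+-identityˡ _) ⟩
    y ^ suc n + x ^ suc n                          ≈⟨ +-comm _ _ ⟩
    x ^ suc n + y ^ suc n                          ∎
    where
    module Binomial = Algebra.Properties.CommutativeSemiring.Binomial commutativeSemiring
    term = Binomial.binomialTerm x y (suc n)

    first : term Fin.zero ≈ y ^ suc n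
    first = trans (×-homo-1 _) (trans (*-identityˡ _) (reflexive (P.sym (^-≡ y (suc n)))))

    middle : ∀ i → term (Fin.suc (Fin.inject₁ i)) ≈ 0#
    middle i = p∣n⇒n·x≈0 p·1≈0 _ (prime∣C p-prime (s≤s z≤n) (s≤s (Fin.inject₁ℕ< i)))

    last : term (Fin.fromℕ (suc n)) ≈ x ^ suc n
    last rewrite Fin.toℕ-fromℕ n | nCn≡1 (suc n) | ℕ.n∸n≡0 n =
      trans (×-homo-1 _) (trans (*-identityʳ _) (reflexive (P.sym (^-≡ x (suc n)))))

  ^-zeroˡ : ∀ n → .{{ℕ.NonZero n}} → 0# ^ n ≈ 0#
  ^-zeroˡ (suc n) = zeroˡ _

  ^[p^n]-distrib-+ : ∀ {p} → Prime p → p · 1# ≈ 0# →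
    ∀ n x y → (x + y) ^ (p ℕ.^ n) ≈ x ^ (p ℕ.^ n) + y ^ (p ℕ.^ n)
  ^[p^n]-distrib-+ p-prime p·1≈0 zero x y = trans (*-identityʳ _)
    (+-cong (sym (*-identityʳ x)) (sym (*-identityʳ y)))
  ^[p^n]-distrib-+ {p} p-prime p·1≈0 (suc n) x y = begin
    (x + y) ^ (p ℕ.* p ℕ.^ n)                  ≈⟨ ^-assocʳ (x + y) p (p ℕ.^ n) ⟨
    ((x + y) ^ p) ^ (p ℕ.^ n)                  ≈⟨ ^-congˡ (p ℕ.^ n) (^p-distrib-+ p-prime p·1≈0 x y) ⟩
    (x ^ p + y ^ p) ^ (p ℕ.^ n)                ≈⟨ ^[p^n]-distrib-+ p-prime p·1≈0 n (x ^ p) (y ^ p) ⟩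
    (x ^ p) ^ (p ℕ.^ n) + (y ^ p) ^ (p ℕ.^ n)  ≈⟨ +-cong (^-assocʳ x p (p ℕ.^ n)) (^-assocʳ y p (p ℕ.^ n)) ⟩
    x ^ (p ℕ.* p ℕ.^ n) + y ^ (p ℕ.* p ℕ.^ n)  ∎

  ^[p^n]-isRingHomomorphism : ∀ {p} → Prime p → p · 1# ≈ 0# →
    ∀ n → IsRingHomomorphism rawRing rawRing (_^ (p ℕ.^ n))
  ^[p^n]-isRingHomomorphism {p} p-prime p·1≈0 n = record
    { isSemiringHomomorphism = record
      { isNearSemiringHomomorphism = record
        { +-isMonoidHomomorphism = record
          { isMagmaHomomorphism = record
            { isRelHomomorphism = record { cong = ^-congˡ (p ℕ.^ n) }
            ; homo              = distrib-+
            }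
          ; ε-homo = 0-homo
          }
        ; *-homo = λ x y → ^-distrib-* x y (p ℕ.^ n)
        }
      ; 1#-homo = 1^n≈1 (p ℕ.^ n)
      }
    ; -‿homo = λ x → +-inverseˡ-unique _ _ (begin
        (- x) ^ (p ℕ.^ n) + x ^ (p ℕ.^ n)  ≈⟨ distrib-+ (- x) x ⟨
        (- x + x) ^ (p ℕ.^ n)              ≈⟨ ^-congˡ (p ℕ.^ n) (-‿inverseˡ x) ⟩
        0# ^ (p ℕ.^ n)                     ≈⟨ 0-homo ⟩
        0#                                 ∎)
    }
    where
    distrib-+ = ^[p^n]-distrib-+ p-prime p·1≈0 n
    0-homo : 0# ^ (p ℕ.^ n) ≈ 0#
    0-homo = ^-zeroˡ (p ℕ.^ n) {{ℕ.m^n≢0 p n {{prime⇒nonZero p-prime}}}}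

  -- If two vanished, an odd multiple of `1#` would be `1#` itself.
  odd·1≈0⇒1+1≉0 : ∀ {n} → Odd n → n · 1# ≈ 0# → 1# + 1# ≉ 0#
  odd·1≈0⇒1+1≉0 (s , P.refl) n·1≈0 1+1≈0 = 1≉0 (begin
    1#                         ≈⟨ +-identityʳ 1# ⟨
    1# + 0#                    ≈⟨ +-congˡ (trans (*-congʳ (trans (+-congˡ (+-identityʳ 1#)) 1+1≈0)) (zeroˡ _)) ⟨
    1# + (2 · 1#) * (s · 1#)   ≈⟨ +-congˡ (×1-homo-* 2 s) ⟨
    (1 ℕ.+ 2 ℕ.* s) · 1#       ≈⟨ n·1≈0 ⟩
    0#                         ∎)

  -- Signs and cancellation.

  neg-^-odd : ∀ x {n} → Odd n → (- x) ^ n ≈ - (x ^ n)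
  neg-^-odd x (s , P.refl) = begin
    - x * (- x) ^ (2 ℕ.* s)     ≈⟨ *-congˡ (^-assocʳ (- x) 2 s) ⟨
    - x * ((- x) ^ 2) ^ s       ≈⟨ *-congˡ (^-congˡ s neg-square) ⟩
    - x * (x ^ 2) ^ s           ≈⟨ *-congˡ (^-assocʳ x 2 s) ⟩
    - x * x ^ (2 ℕ.* s)         ≈⟨ -‿distribˡ-* x _ ⟨
    - (x * x ^ (2 ℕ.* s))       ∎
    where
    neg-square : (- x) ^ 2 ≈ x ^ 2
    neg-square = begin
      - x * (- x * 1#)   ≈⟨ *-congˡ (-‿distribˡ-* x 1#) ⟨
      - x * - (x * 1#)   ≈⟨ -‿distribˡ-* x _ ⟨
      - (x * - (x * 1#)) ≈⟨ -‿cong (-‿distribʳ-* x _) ⟨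
      - - (x * (x * 1#)) ≈⟨ -‿involutive _ ⟩
      x * (x * 1#)       ∎

  p+s≈r+q⇒p-q≈r-s : ∀ {p q r s} → p + s ≈ r + q → p - q ≈ r - s
  p+s≈r+q⇒p-q≈r-s {p} {q} {r} {s} p+s≈r+q = +-cancelʳ (q + s) _ _ (begin
    -- The semiring solver treats `- q` as an independent variable; it cancels against `q` in the
    -- next step.
    (p - q) + (q + s)   ≈⟨ solve 4 (λ p q n s → (p :+ n) :+ (q :+ s) := (p :+ s) :+ (n :+ q)) refl p q (- q) s ⟩
    (p + s) + (- q + q) ≈⟨ +-cong p+s≈r+q (trans (-‿inverseˡ q) (sym (-‿inverseˡ s))) ⟩
    (r + q) + (- s + s) ≈⟨ solve 4 (λ r q n s → (r :+ q) :+ (n :+ s) := (r :+ n) :+ (q :+ s)) refl r q (- s) s ⟩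
    (r - s) + (q + s)   ∎)

  *-cancel-2 : 1# + 1# ≉ 0# → ∀ {x y} → x + x ≈ y + y → x ≈ y
  *-cancel-2 2≉0 {x} {y} x+x≈y+y = *-cancelˡ 2≉0 (begin
    (1# + 1#) * x  ≈⟨ solve 1 (λ x → (con 1 :+ con 1) :* x := x :+ x) refl x ⟩
    x + x          ≈⟨ x+x≈y+y ⟩
    y + y          ≈⟨ solve 1 (λ x → (con 1 :+ con 1) :* x := x :+ x) refl y ⟨
    (1# + 1#) * y  ∎)

  -- Iterated power maps and their fixed elements.

  ^-^-comm : ∀ x m n → (x ^ m) ^ n ≈ (x ^ n) ^ m
  ^-^-comm x m n = begin
    (x ^ m) ^ n    ≈⟨ ^-assocʳ x m n ⟩
    x ^ (m ℕ.* n)  ≡⟨ P.cong (x ^_) (ℕ.*-comm m n) ⟩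
    x ^ (n ℕ.* m)  ≈⟨ ^-assocʳ x n m ⟨
    (x ^ n) ^ m    ∎

  ^[q^[m+n]] : ∀ q x m n → x ^ (q ℕ.^ (m ℕ.+ n)) ≈ (x ^ (q ℕ.^ m)) ^ (q ℕ.^ n)
  ^[q^[m+n]] q x m n = begin
    x ^ (q ℕ.^ (m ℕ.+ n))         ≡⟨ P.cong (x ^_) (ℕ.^-distribˡ-+-* q m n) ⟩
    x ^ (q ℕ.^ m ℕ.* q ℕ.^ n)     ≈⟨ ^-assocʳ x (q ℕ.^ m) (q ℕ.^ n) ⟨
    (x ^ (q ℕ.^ m)) ^ (q ℕ.^ n)   ∎

  ^[q^1] : ∀ q x → x ^ (q ℕ.^ 1) ≈ x ^ q
  ^[q^1] q x = reflexive (P.cong (x ^_) (ℕ.*-identityʳ q))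

  fixed-multiple : ∀ q {x} n → x ^ (q ℕ.^ n) ≈ x → ∀ k → x ^ (q ℕ.^ (k ℕ.* n)) ≈ x
  fixed-multiple q {x} n fixed zero    = *-identityʳ x
  fixed-multiple q {x} n fixed (suc k) = begin
    x ^ (q ℕ.^ (n ℕ.+ k ℕ.* n))           ≈⟨ ^[q^[m+n]] q x n (k ℕ.* n) ⟩
    (x ^ (q ℕ.^ n)) ^ (q ℕ.^ (k ℕ.* n))   ≈⟨ ^-congˡ (q ℕ.^ (k ℕ.* n)) fixed ⟩
    x ^ (q ℕ.^ (k ℕ.* n))                 ≈⟨ fixed-multiple q n fixed k ⟩
    x                                     ∎

  fixed-consecutive : ∀ q {x} n → x ^ (q ℕ.^ n) ≈ x → x ^ (q ℕ.^ suc n) ≈ x → x ^ q ≈ x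
  fixed-consecutive q {x} n fixed-n fixed-1+n = begin
    x ^ q                        ≈⟨ ^-congˡ q fixed-n ⟨
    (x ^ (q ℕ.^ n)) ^ q          ≈⟨ ^-^-comm x (q ℕ.^ n) q ⟩
    (x ^ q) ^ (q ℕ.^ n)          ≈⟨ ^-assocʳ x q (q ℕ.^ n) ⟩
    x ^ (q ℕ.^ suc n)            ≈⟨ fixed-1+n ⟩
    x                            ∎

  -- Bézout gives a multiple of `m` and a multiple of `n` that differ by one, so two consecutive
  -- iterates of the `q`-th power map fix `x`, and hence the map itself does.
  fixed-coprime : ∀ q {x} m n → gcd m n ≡ 1 →
    x ^ (q ℕ.^ m) ≈ x → x ^ (q ℕ.^ n) ≈ x → x ^ q ≈ x
  fixed-coprime q {x} m n gcd≡1 fixed-m fixed-n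
    with Bézout.identity (P.subst (GCD m n) gcd≡1 (gcd-GCD m n))
  ... | Bézout.+- k l 1+ln≡km = fixed-consecutive q (l ℕ.* n) (fixed-multiple q n fixed-n l)
          (P.subst (λ e → x ^ (q ℕ.^ e) ≈ x) (P.sym 1+ln≡km) (fixed-multiple q m fixed-m k))
  ... | Bézout.-+ k l 1+km≡ln = fixed-consecutive q (k ℕ.* m) (fixed-multiple q m fixed-m k)
          (P.subst (λ e → x ^ (q ℕ.^ e) ≈ x) (P.sym 1+km≡ln) (fixed-multiple q n fixed-n l))

  -- Symmetric and skew elements for two commuting ring endomorphisms.

  module TwistedEquation
    (1+1≉0 : 1# + 1# ≉ 0#) (S B : Carrier → Carrier)
    (S-hom : IsRingHomomorphism rawRing rawRing S)
    (B-hom : IsRingHomomorphism rawRing rawRing B)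
    (BS≈SB : ∀ x → B (S x) ≈ S (B x))
    where

    private
      module S = IsRingHomomorphism S-hom
      module B = IsRingHomomorphism B-hom

    Symmetric Skew : Carrier → Set
    Symmetric x = B x ≈ x
    Skew x = B x ≈ - x

    symmetric-+ : ∀ {x y} → Symmetric x → Symmetric y → Symmetric (x + y)
    symmetric-+ x-sym y-sym = trans (B.+-homo _ _) (+-cong x-sym y-sym)

    skew-+ : ∀ {x y} → Skew x → Skew y → Skew (x + y)
    skew-+ x-skew y-skew = trans (B.+-homo _ _) (trans (+-cong x-skew y-skew) (-‿+-comm _ _))

    skew-neg : ∀ {x} → Skew x → Skew (- x)
    skew-neg x-skew = trans (B.-‿homo _) (-‿cong x-skew)

    symmetric-* : ∀ {x y} → Symmetric x → Symmetric y → Symmetric (x * y)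
    symmetric-* x-sym y-sym = trans (B.*-homo _ _) (*-cong x-sym y-sym)

    symmetric-*-skew : ∀ {x y} → Symmetric x → Skew y → Skew (x * y)
    symmetric-*-skew x-sym y-skew =
      trans (B.*-homo _ _) (trans (*-cong x-sym y-skew) (sym (-‿distribʳ-* _ _)))

    skew-*-symmetric : ∀ {x y} → Skew x → Symmetric y → Skew (x * y)
    skew-*-symmetric x-skew y-sym =
      trans (B.*-homo _ _) (trans (*-cong x-skew y-sym) (sym (-‿distribˡ-* _ _)))

    skew-*-skew : ∀ {x y} → Skew x → Skew y → Symmetric (x * y)
    skew-*-skew {x} {y} x-skew y-skew = begin
      B (x * y)    ≈⟨ B.*-homo x y ⟩
      B x * B y    ≈⟨ *-cong x-skew y-skew ⟩
      - x * - y    ≈⟨ -‿distribˡ-* x (- y) ⟨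
      - (x * - y)  ≈⟨ -‿cong (-‿distribʳ-* x y) ⟨
      - - (x * y)  ≈⟨ -‿involutive (x * y) ⟩
      x * y        ∎

    symmetric-S : ∀ {x} → Symmetric x → Symmetric (S x)
    symmetric-S x-sym = trans (BS≈SB _) (S.⟦⟧-cong x-sym)

    skew-S : ∀ {x} → Skew x → Skew (S x)
    skew-S x-skew = trans (BS≈SB _) (trans (S.⟦⟧-cong x-skew) (S.-‿homo _))

    -- Applying `B` turns the equation of sums into one of differences. Adding the two leaves twice
    -- the symmetric parts, and two can be cancelled.
    split : ∀ {k k′ w w′} → Symmetric k → Symmetric k′ → Skew w → Skew w′ →
      k + w ≈ k′ + w′ → k ≈ k′ × w ≈ w′
    split {k} {k′} {w} {w′} k-sym k′-sym w-skew w′-skew k+w≈k′+w′ =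
      k≈k′ , +-cancelˡ k w w′ (trans k+w≈k′+w′ (+-congʳ (sym k≈k′)))
      where
      k-w≈k′-w′ : k - w ≈ k′ - w′
      k-w≈k′-w′ = begin
        k - w        ≈⟨ +-cong k-sym w-skew ⟨
        B k + B w    ≈⟨ B.+-homo k w ⟨
        B (k + w)    ≈⟨ B.⟦⟧-cong k+w≈k′+w′ ⟩
        B (k′ + w′)  ≈⟨ B.+-homo k′ w′ ⟩
        B k′ + B w′  ≈⟨ +-cong k′-sym w′-skew ⟩
        k′ - w′      ∎

      sum+difference : ∀ k w → (k + w) + (k - w) ≈ k + k
      sum+difference k w = begin
        (k + w) + (k - w)  ≈⟨ solve 3 (λ k w n → (k :+ w) :+ (k :+ n) := (k :+ k) :+ (w :+ n)) refl k w (- w) ⟩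
        (k + k) + (w - w)  ≈⟨ +-congˡ (-‿inverseʳ w) ⟩
        (k + k) + 0#       ≈⟨ +-identityʳ _ ⟩
        k + k              ∎

      k≈k′ : k ≈ k′
      k≈k′ = *-cancel-2 1+1≉0 (begin
        k + k                  ≈⟨ sum+difference k w ⟨
        (k + w) + (k - w)      ≈⟨ +-cong k+w≈k′+w′ k-w≈k′-w′ ⟩
        (k′ + w′) + (k′ - w′)  ≈⟨ sum+difference k′ w′ ⟩
        k′ + k′                ∎)

    -- The hypothesis is the cross-multiplied form of `S (u / v) = u / v`. Cancelling `S v` is
    -- allowed because a ring homomorphism sends the unit `v` to a unit.
    ratio-fixed : ∀ {u v} → v ≉ 0# → u * S v ≈ v * S u → ∃[ l ] S l ≈ l × u ≈ l * v
    ratio-fixed {u} {v} v≉0 u*Sv≈v*Su = l , Sl≈l , u≈lv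
      where
      l = v ⁻¹ * u

      u≈lv : u ≈ l * v
      u≈lv = trans (sym (x[x⁻¹y]≈y u v≉0)) (*-comm v l)

      Sv≉0 : S v ≉ 0#
      Sv≉0 Sv≈0 = 1≉0 (begin
        1#               ≈⟨ S.1#-homo ⟨
        S 1#             ≈⟨ S.⟦⟧-cong (inverseʳ v v≉0) ⟨
        S (v * v ⁻¹)     ≈⟨ S.*-homo v (v ⁻¹) ⟩
        S v * S (v ⁻¹)   ≈⟨ trans (*-congʳ Sv≈0) (zeroˡ _) ⟩
        0#               ∎)

      Sl≈l : S l ≈ l
      Sl≈l = *-cancelˡ v≉0 (*-cancelˡ Sv≉0 (begin
        S v * (v * S l)  ≈⟨ solve 3 (λ a b c → a :* (b :* c) := b :* (c :* a)) refl (S v) v (S l) ⟩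
        v * (S l * S v)  ≈⟨ *-congˡ (S.*-homo l v) ⟨
        v * S (l * v)    ≈⟨ *-congˡ (S.⟦⟧-cong u≈lv) ⟨
        v * S u          ≈⟨ u*Sv≈v*Su ⟨
        u * S v          ≈⟨ *-comm u (S v) ⟩
        S v * u          ≈⟨ *-congˡ (trans u≈lv (*-comm l v)) ⟩
        S v * (v * l)    ∎))

    -- For `S x = x ^ σ`, the first two cases express `m = (1 / z) ^ (σ - 1)` and
    -- `m = (1 / r) ^ (σ + 1)` without division.
    data Outcome (m x y : Carrier) : Set where
      power-minus : ∀ z → Skew z → z ≉ 0# → m * S z ≈ z → Outcome m x y
      power-plus  : ∀ r → Skew r → m * (r * S r) ≈ 1# → Outcome m x y
      fixed-ratio : ∀ l → S l ≈ l → x ≈ l * y → Outcome m x y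

    -- Solving the twisted equation.

    module _ {m a b c d x y : Carrier} (m≉0 : m ≉ 0#) (y≉0 : y ≉ 0#)
      (m-sym : Symmetric m) (a-sym : Symmetric a) (c-sym : Symmetric c) (b-skew : Skew b) (d-skew : Skew d)
      (2x≈Sa+b : x + x ≈ S a + b) (2y≈Sc+d : y + y ≈ S c + d)
      (twisted : (a + m * S b) * y ≈ (c + m * S d) * x)
      where

      private
        -- Doubling makes `S c + d` available in place of `y + y`; the result is grouped so that,
        -- for the elements at hand, the first bracket is symmetric and the second skew.
        expand : ∀ {a b c d y} → y + y ≈ S c + d →
          (a + m * S b) * y + (a + m * S b) * y ≈
          (a * S c + m * S b * d) + (a * d + m * S b * S c)
        expand {a} {b} {c} {d} {y} 2y≈Sc+d = begin
          (a + m * S b) * y + (a + m * S b) * y  ≈⟨ distribˡ _ y y ⟨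
          (a + m * S b) * (y + y)                ≈⟨ *-congˡ 2y≈Sc+d ⟩
          (a + m * S b) * (S c + d)
            ≈⟨ solve 4 (λ a b c d → (a :+ b) :* (c :+ d) := (a :* c :+ b :* d) :+ (a :* d :+ b :* c)) refl a (m * S b) (S c) d ⟩
          (a * S c + m * S b * d) + (a * d + m * S b * S c) ∎

        -- The two sides of the doubled equation have equal symmetric and equal skew components: a
        -- product of two symmetric or two skew elements is symmetric, a mixed one is skew.
        parts : a * S c + m * S b * d ≈ c * S a + m * S d * b × a * d + m * S b * S c ≈ c * b + m * S d * S a
        parts = split
          (symmetric-part a-sym c-sym b-skew d-skew) (symmetric-part c-sym a-sym d-skew b-skew)
          (skew-part a-sym c-sym b-skew d-skew) (skew-part c-sym a-sym d-skew b-skew)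
          (trans (sym (expand 2y≈Sc+d)) (trans (+-cong twisted twisted) (expand 2x≈Sa+b)))
          where
          symmetric-part : ∀ {a b c d} → Symmetric a → Symmetric c → Skew b → Skew d → Symmetric (a * S c + m * S b * d)
          symmetric-part a c b d = symmetric-+ (symmetric-* a (symmetric-S c))
            (skew-*-skew (symmetric-*-skew m-sym (skew-S b)) d)

          skew-part : ∀ {a b c d} → Symmetric a → Symmetric c → Skew b → Skew d → Skew (a * d + m * S b * S c)
          skew-part a c b d = skew-+ (symmetric-*-skew a d)
            (skew-*-symmetric (symmetric-*-skew m-sym (skew-S b)) (symmetric-S c))

        -- The determinant of the pairs `(a , b)` and `(c , d)`.
        z = a * d - c * b

        z-skew : Skew z
        z-skew = skew-+ (symmetric-*-skew a-sym d-skew) (skew-neg (symmetric-*-skew c-sym b-skew))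

        -- A rearrangement of the skew component in `parts`.
        m*Sz≈z : m * S z ≈ z
        m*Sz≈z = begin
          m * S z                          ≈⟨ *-congˡ (S.+-homo _ _) ⟩
          m * (S (a * d) + S (- (c * b)))  ≈⟨ *-congˡ (+-cong (S.*-homo a d) (trans (S.-‿homo _) (-‿cong (S.*-homo c b)))) ⟩
          m * (S a * S d - S c * S b)      ≈⟨ x[y-z]≈xy-xz m _ _ ⟩
          m * (S a * S d) - m * (S c * S b)
            ≈⟨ p+s≈r+q⇒p-q≈r-s (trans (+-congˡ (reorder c b)) (trans (proj₂ parts) (trans (+-comm _ _) (+-congʳ (sym (reorder a d)))))) ⟨
          z                                ∎
          where
          reorder : ∀ u v → m * (S u * S v) ≈ m * S v * S u
          reorder u v = solve 3 (λ m u v → m :* (u :* v) := m :* v :* u) refl m (S u) (S v)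

      halve : ∀ {l} → x + x ≈ l * (y + y) → x ≈ l * y
      halve 2x≈l2y = *-cancel-2 1+1≉0 (trans 2x≈l2y (distribˡ _ y y))

      -- With `r = d / c` also `b = a * r`, and the symmetric component becomes
      -- `(a * S c - c * S a) * (1 - u) = 0` for `u = m * r * S r`. Either `u = 1`, or `a / c` is
      -- fixed by `S`.
      outcome-proportional : c ≉ 0# → a * d ≈ c * b → Outcome m x y
      outcome-proportional c≉0 ad≈cb = conclude
        where
        r = c ⁻¹ * d

        d≈cr : d ≈ c * r
        d≈cr = sym (x[x⁻¹y]≈y d c≉0)

        b≈ar : b ≈ a * r
        b≈ar = *-cancelˡ c≉0 (begin
          c * b        ≈⟨ ad≈cb ⟨
          a * d        ≈⟨ *-congˡ d≈cr ⟩
          a * (c * r)  ≈⟨ solve 3 (λ a c r → a :* (c :* r) := c :* (a :* r)) refl a c r ⟩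
          c * (a * r)  ∎)

        r-skew : Skew r
        r-skew = *-cancelˡ c≉0 (begin
          c * B r    ≈⟨ *-congʳ c-sym ⟨
          B c * B r  ≈⟨ B.*-homo c r ⟨
          B (c * r)  ≈⟨ B.⟦⟧-cong d≈cr ⟨
          B d        ≈⟨ d-skew ⟩
          - d        ≈⟨ -‿cong d≈cr ⟩
          - (c * r)  ≈⟨ -‿distribʳ-* c r ⟩
          c * - r    ∎)

        u = m * (r * S r)

        -- The pairs are quantified afresh so that their roles can be exchanged.
        scaled : ∀ {a b c d} → b ≈ a * r → d ≈ c * r → m * S b * d ≈ u * (c * S a)
        scaled {a} {b} {c} {d} b≈ar d≈cr = begin
          m * S b * d              ≈⟨ *-cong (*-congˡ (trans (S.⟦⟧-cong b≈ar) (S.*-homo a r))) d≈cr ⟩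
          m * (S a * S r) * (c * r)
            ≈⟨ solve 5 (λ m a s c r → m :* (a :* s) :* (c :* r) := m :* (r :* s) :* (c :* a)) refl m (S a) (S r) c r ⟩
          u * (c * S a)            ∎

        difference : a * S c - c * S a ≈ u * (a * S c) - u * (c * S a)
        difference = p+s≈r+q⇒p-q≈r-s (begin
          a * S c + u * (c * S a)  ≈⟨ +-congˡ (scaled b≈ar d≈cr) ⟨
          a * S c + m * S b * d    ≈⟨ proj₁ parts ⟩
          c * S a + m * S d * b    ≈⟨ +-congˡ (scaled d≈cr b≈ar) ⟩
          c * S a + u * (a * S c)  ≈⟨ +-comm _ _ ⟩
          u * (a * S c) + c * S a  ∎)

        conclude : Outcome m x y
        conclude with a * S c ≟ c * S a
        ... | no  aSc≉cSa = power-plus r r-skew (*-cancelˡ (aSc≉cSa ∘ x∙y⁻¹≈ε⇒x≈y _ _) (begin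
          (a * S c - c * S a) * u        ≈⟨ *-comm _ u ⟩
          u * (a * S c - c * S a)        ≈⟨ x[y-z]≈xy-xz u _ _ ⟩
          u * (a * S c) - u * (c * S a)  ≈⟨ difference ⟨
          a * S c - c * S a              ≈⟨ *-identityʳ _ ⟨
          (a * S c - c * S a) * 1#       ∎))
        -- Here `l = a / c`, and `b = a * r = l * d`; as `S` fixes `l`, the whole of `S a + b` is
        -- `l` times `S c + d`.
        ... | yes aSc≈cSa with l , Sl≈l , a≈lc ← ratio-fixed c≉0 aSc≈cSa = fixed-ratio l Sl≈l (halve (begin
          x + x                      ≈⟨ 2x≈Sa+b ⟩
          S a + b                    ≈⟨ +-cong (trans (S.⟦⟧-cong a≈lc) (S.*-homo l c)) (trans b≈ar (*-congʳ a≈lc)) ⟩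
          S l * S c + l * c * r      ≈⟨ +-cong (*-congʳ Sl≈l) (trans (*-assoc l c r) (*-congˡ (sym d≈cr))) ⟩
          l * S c + l * d            ≈⟨ distribˡ l (S c) d ⟨
          l * (S c + d)              ≈⟨ *-congˡ 2y≈Sc+d ⟨
          l * (y + y)                ∎))

      -- Now `2 y = d` is nonzero, so the determinant condition forces `a = 0` and `2 x = b`. The
      -- symmetric component, divided by `m`, says that `b / d` is fixed by `S`.
      outcome-degenerate : c ≈ 0# → a * d ≈ c * b → Outcome m x y
      outcome-degenerate c≈0 ad≈cb =
        let l , Sl≈l , b≈ld = ratio-fixed d≉0 bSd≈dSb in
        fixed-ratio l Sl≈l (halve (begin
          x + x        ≈⟨ trans 2x≈Sa+b (Su+v≈v a≈0) ⟩
          b            ≈⟨ b≈ld ⟩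
          l * d        ≈⟨ *-congˡ (trans 2y≈Sc+d (Su+v≈v c≈0)) ⟨
          l * (y + y)  ∎))
        where
        Su≈0 : ∀ {u} → u ≈ 0# → S u ≈ 0#
        Su≈0 u≈0 = trans (S.⟦⟧-cong u≈0) S.0#-homo

        Su+v≈v : ∀ {u v} → u ≈ 0# → S u + v ≈ v
        Su+v≈v u≈0 = trans (+-congʳ (Su≈0 u≈0)) (+-identityˡ _)

        d≉0 : d ≉ 0#
        d≉0 d≈0 = y≉0 (*-cancel-2 1+1≉0
          (trans 2y≈Sc+d (trans (Su+v≈v c≈0) (trans d≈0 (sym (+-identityˡ 0#))))))

        a≈0 : a ≈ 0#
        a≈0 = x≉0∧xy≈0⇒y≈0 d≉0 (trans (*-comm d a) (trans ad≈cb (trans (*-congʳ c≈0) (zeroˡ b))))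

        u*Sv+w≈w : ∀ {u v w} → v ≈ 0# → u * S v + w ≈ w
        u*Sv+w≈w v≈0 = trans (+-congʳ (trans (*-congˡ (Su≈0 v≈0)) (zeroʳ _))) (+-identityˡ _)

        bSd≈dSb : b * S d ≈ d * S b
        bSd≈dSb = *-cancelˡ m≉0 (begin
          m * (b * S d)            ≈⟨ solve 3 (λ m b d → m :* (b :* d) := m :* d :* b) refl m b (S d) ⟩
          m * S d * b              ≈⟨ u*Sv+w≈w a≈0 ⟨
          c * S a + m * S d * b    ≈⟨ proj₁ parts ⟨
          a * S c + m * S b * d    ≈⟨ u*Sv+w≈w c≈0 ⟩
          m * S b * d              ≈⟨ solve 3 (λ m b d → m :* b :* d := m :* (d :* b)) refl m (S b) d ⟩
          m * (d * S b)            ∎)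

      outcome : Outcome m x y
      outcome with z ≟ 0#
      ... | no  z≉0 = power-minus z z-skew z≉0 m*Sz≈z
      ... | yes z≈0 with c ≟ 0#
      ...   | yes c≈0 = outcome-degenerate c≈0 (x∙y⁻¹≈ε⇒x≈y _ _ z≈0)
      ...   | no  c≉0 = outcome-proportional c≉0 (x∙y⁻¹≈ε⇒x≈y _ _ z≈0)

-- The power maps with exponents `σ` and `q ^ t` on the field of order `q ^ (2 * t)`.

module QuadrinomialScattered (q t J : ℕ) (q-odd : Odd q) (J-odd : Odd J) (1≤t : 1 ℕ.≤ t)
  (gcd≡1 : gcd J (2 ℕ.* t) ≡ 1) (F : FiniteField (q ℕ.^ (2 ℕ.* t)))
  where

  open FiniteField F
  open FieldProperties F
  open Algebra.Properties.Ring ring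
  open Relation.Binary.Reasoning.Setoid setoid
  open Algebra.Solver.Ring.NaturalCoefficients.Default commutativeSemiring

  module _ (1+1≉0 : 1# + 1# ≉ 0#)
    (frobenius-hom : ∀ n → IsRingHomomorphism rawRing rawRing (_^ (q ℕ.^ n)))
    where

    σ : ℕ
    σ = q ℕ.^ J

    S B P′ : Carrier → Carrier
    S x  = x ^ σ
    B x  = x ^ (q ℕ.^ t)
    P′ x = x ^ (σ ℕ.^ (t ℕ.∸ 1))

    private
      module S = IsRingHomomorphism (frobenius-hom J)
      module B = IsRingHomomorphism (frobenius-hom t)

    open TwistedEquation 1+1≉0 S B (frobenius-hom J) (frobenius-hom t) (λ x → ^-^-comm x σ (q ℕ.^ t))

    B-involutive : ∀ x → B (B x) ≈ x
    B-involutive x = begin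
      B (B x)                 ≈⟨ ^[q^[m+n]] q x t t ⟨
      x ^ (q ℕ.^ (t ℕ.+ t))   ≡⟨ P.cong (λ n → x ^ (q ℕ.^ (t ℕ.+ n))) (ℕ.+-identityʳ t) ⟨
      x ^ (q ℕ.^ (2 ℕ.* t))   ≈⟨ x^N≈x x ⟩
      x                       ∎

    -- J is odd, so J * t is congruent to t modulo 2 * t.
    ^[σ^t]≈B : ∀ x → x ^ (σ ℕ.^ t) ≈ B x
    ^[σ^t]≈B x = begin
      x ^ (σ ℕ.^ t)                          ≡⟨ P.cong (x ^_) (ℕ.^-*-assoc q J t) ⟩
      x ^ (q ℕ.^ (J ℕ.* t))                  ≡⟨ P.cong (λ n → x ^ (q ℕ.^ n)) Jt≡t+i2t ⟩
      x ^ (q ℕ.^ (t ℕ.+ i ℕ.* (2 ℕ.* t)))    ≈⟨ ^[q^[m+n]] q x t (i ℕ.* (2 ℕ.* t)) ⟩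
      B x ^ (q ℕ.^ (i ℕ.* (2 ℕ.* t)))        ≈⟨ fixed-multiple q (2 ℕ.* t) (x^N≈x (B x)) i ⟩
      B x                                    ∎
      where
      i = proj₁ J-odd

      Jt≡t+i2t : J ℕ.* t ≡ t ℕ.+ i ℕ.* (2 ℕ.* t)
      Jt≡t+i2t = P.trans (P.cong (ℕ._* t) (proj₂ J-odd))
        (P.cong (t ℕ.+_) (P.trans (P.cong (ℕ._* t) (ℕ.*-comm 2 i)) (ℕ.*-assoc i 2 t)))

    -- Composing the two maps multiplies the exponents to `σ ^ t`. Through this identity `S`
    -- recovers `B x + x` from the symmetric part of `x`.
    SP≈B : ∀ x → S (P′ x) ≈ B x
    SP≈B x = begin
      S (P′ x)                                ≈⟨ ^[q^1] σ (P′ x) ⟨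
      P′ x ^ (σ ℕ.^ 1)                        ≈⟨ ^[q^[m+n]] σ x (t ℕ.∸ 1) 1 ⟨
      x ^ (σ ℕ.^ (t ℕ.∸ 1 ℕ.+ 1))             ≡⟨ P.cong (λ n → x ^ (σ ℕ.^ n)) (ℕ.m∸n+n≡m 1≤t) ⟩
      x ^ (σ ℕ.^ t)                           ≈⟨ ^[σ^t]≈B x ⟩
      B x                                     ∎

    -- Since `2 t - 1 = (t - 1) + t`, the second term of `φ` is the image under `B` of the first.
    BP≈ : ∀ x → x ^ (σ ℕ.^ (2 ℕ.* t ℕ.∸ 1)) ≈ B (P′ x)
    BP≈ x = begin
      x ^ (σ ℕ.^ (2 ℕ.* t ℕ.∸ 1))        ≡⟨ P.cong (λ n → x ^ (σ ℕ.^ n)) 2t∸1≡t∸1+t ⟩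
      x ^ (σ ℕ.^ (t ℕ.∸ 1 ℕ.+ t))        ≈⟨ ^[q^[m+n]] σ x (t ℕ.∸ 1) t ⟩
      P′ x ^ (σ ℕ.^ t)                   ≈⟨ ^[σ^t]≈B (P′ x) ⟩
      B (P′ x)                           ∎
      where
      2t∸1≡t∸1+t : 2 ℕ.* t ℕ.∸ 1 ≡ t ℕ.∸ 1 ℕ.+ t
      2t∸1≡t∸1+t = P.trans (P.cong (λ n → t ℕ.+ n ℕ.∸ 1) (ℕ.+-identityʳ t)) (ℕ.+-∸-comm t 1≤t)

    SB≈ : ∀ x → x ^ (σ ℕ.^ (t ℕ.+ 1)) ≈ S (B x)
    SB≈ x = begin
      x ^ (σ ℕ.^ (t ℕ.+ 1))          ≈⟨ ^[q^[m+n]] σ x t 1 ⟩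
      (x ^ (σ ℕ.^ t)) ^ (σ ℕ.^ 1)    ≈⟨ ^[q^1] σ _ ⟩
      S (x ^ (σ ℕ.^ t))              ≈⟨ S.⟦⟧-cong (^[σ^t]≈B x) ⟩
      S (B x)                        ∎

    -- Decomposition of `x` and of `φ` into symmetric and skew parts.

    symmetricPart skewPart : Carrier → Carrier
    symmetricPart x = P′ x + B (P′ x)
    skewPart x      = x - B x

    symmetricPart-symmetric : ∀ x → Symmetric (symmetricPart x)
    symmetricPart-symmetric x = begin
      B (P′ x + B (P′ x))      ≈⟨ B.+-homo _ _ ⟩
      B (P′ x) + B (B (P′ x))  ≈⟨ +-congˡ (B-involutive (P′ x)) ⟩
      B (P′ x) + P′ x          ≈⟨ +-comm _ _ ⟩
      symmetricPart x          ∎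

    skewPart-skew : ∀ x → Skew (skewPart x)
    skewPart-skew x = begin
      B (x - B x)        ≈⟨ B.+-homo _ _ ⟩
      B x + B (- B x)    ≈⟨ +-congˡ (trans (B.-‿homo _) (-‿cong (B-involutive x))) ⟩
      B x - x            ≈⟨ ⁻¹-anti-homo-// x (B x) ⟨
      - (x - B x)        ∎

    -- `S` maps the symmetric part to `B x + x`, and adding `x - B x` removes `B x`.
    2x≈S[symmetric]+skew : ∀ x → x + x ≈ S (symmetricPart x) + skewPart x
    2x≈S[symmetric]+skew x = sym (begin
      S (P′ x + B (P′ x)) + (x - B x)  ≈⟨ +-congʳ (S.+-homo _ _) ⟩
      S (P′ x) + S (B (P′ x)) + (x - B x)
        ≈⟨ +-congʳ (+-cong (SP≈B x) (trans (^-^-comm (P′ x) (q ℕ.^ t) σ) (trans (B.⟦⟧-cong (SP≈B x)) (B-involutive x)))) ⟩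
      B x + x + (x - B x)              ≈⟨ solve 3 (λ b x n → (b :+ x) :+ (x :+ n) := (x :+ x) :+ (b :+ n)) refl (B x) x (- B x) ⟩
      (x + x) + (B x - B x)            ≈⟨ trans (+-congˡ (-‿inverseʳ (B x))) (+-identityʳ _) ⟩
      x + x                            ∎)

    φ-decomposition : ∀ m x → φ F σ t m x ≈ symmetricPart x + m * S (skewPart x)
    φ-decomposition m x = +-cong (+-congˡ (BP≈ x)) (*-congˡ (begin
      S x - x ^ (σ ℕ.^ (t ℕ.+ 1))  ≈⟨ +-congˡ (-‿cong (SB≈ x)) ⟩
      S x - S (B x)                ≈⟨ +-congˡ (S.-‿homo (B x)) ⟨
      S x + S (- B x)              ≈⟨ S.+-homo x (- B x) ⟨
      S (skewPart x)               ∎))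

    -- From skew elements to powers of elements of `W`.

    skew-⁻¹ : ∀ {z} → z ≉ 0# → Skew z → Skew (z ⁻¹)
    skew-⁻¹ {z} z≉0 z-skew = *-cancelˡ z≉0 (begin
      z * B (z ⁻¹)        ≈⟨ *-congʳ (-‿involutive z) ⟨
      - - z * B (z ⁻¹)    ≈⟨ *-congʳ (-‿cong z-skew) ⟨
      - B z * B (z ⁻¹)    ≈⟨ -‿distribˡ-* (B z) _ ⟨
      - (B z * B (z ⁻¹))  ≈⟨ -‿cong (B.*-homo z (z ⁻¹)) ⟨
      - B (z * z ⁻¹)      ≈⟨ -‿cong (trans (B.⟦⟧-cong (inverseʳ z z≉0)) B.1#-homo) ⟩
      - 1#                ≈⟨ -‿cong (inverseʳ z z≉0) ⟨
      - (z * z ⁻¹)        ≈⟨ -‿distribʳ-* z _ ⟩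
      z * - (z ⁻¹)        ∎)

    inverse-power : ∀ {m z} n → z ≉ 0# → m * z ^ n ≈ 1# → (z ⁻¹) ^ n ≈ m
    inverse-power {m} {z} n z≉0 m*z^n≈1 = begin
      (z ⁻¹) ^ n                ≈⟨ *-identityˡ _ ⟨
      1# * (z ⁻¹) ^ n           ≈⟨ *-congʳ m*z^n≈1 ⟨
      m * z ^ n * (z ⁻¹) ^ n    ≈⟨ *-assoc _ _ _ ⟩
      m * (z ^ n * (z ⁻¹) ^ n)  ≈⟨ *-congˡ (^-distrib-* z (z ⁻¹) n) ⟨
      m * (z * z ⁻¹) ^ n        ≈⟨ *-congˡ (trans (^-congˡ n (inverseʳ z z≉0)) (1^n≈1 n)) ⟩
      m * 1#                    ≈⟨ *-identityʳ m ⟩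
      m                         ∎

    -- The element of `W` is `(z ⁻¹) ^ k`: an odd power of a skew element is skew, and its `e`-th
    -- power is `m`.
    powerFromW : ∀ {m z k} e → Odd k → z ≉ 0# → Skew z → m * z ^ (k ℕ.* e) ≈ 1# → PowerFromW F q t e m
    powerFromW {m} {z} {k} e k-odd z≉0 z-skew m*z^ke≈1 =
      (z ⁻¹) ^ k , in-W , trans (^-assocʳ (z ⁻¹) k e) (inverse-power (k ℕ.* e) z≉0 m*z^ke≈1)
      where
      in-W : InW F q t ((z ⁻¹) ^ k)
      in-W = begin
        B ((z ⁻¹) ^ k) + (z ⁻¹) ^ k    ≈⟨ +-congʳ (^-^-comm (z ⁻¹) k (q ℕ.^ t)) ⟩
        B (z ⁻¹) ^ k + (z ⁻¹) ^ k      ≈⟨ +-congʳ (^-congˡ k (skew-⁻¹ z≉0 z-skew)) ⟩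
        (- (z ⁻¹)) ^ k + (z ⁻¹) ^ k    ≈⟨ +-congʳ (neg-^-odd (z ⁻¹) k-odd) ⟩
        - ((z ⁻¹) ^ k) + (z ⁻¹) ^ k    ≈⟨ -‿inverseˡ _ ⟩
        0#                             ∎

    -- Zero lies in `W`, so the assumption that `m` is not such a power also gives `m ≉ 0#`.
    zero-powerFromW : ∀ {m} e → m ≈ 0# → PowerFromW F q t (suc e) m
    zero-powerFromW e m≈0 = 0# , trans (+-identityʳ _) B.0#-homo , trans (zeroˡ _) (sym m≈0)

    -- As `σ = 1 + k * (q - 1)` with `k` odd, cancelling `z` from `m * z ^ σ = z` leaves
    -- `m * z ^ (k * (q - 1)) = 1`.
    power-minus⇒powerFromW : ∀ {m z} → Skew z → z ≉ 0# → m * S z ≈ z → PowerFromW F q t (q ℕ.∸ 1) m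
    power-minus⇒powerFromW {m} {z} z-skew z≉0 m*Sz≈z with odd-quotient-minus q-odd J-odd
    ... | k , k-odd , σ≡1+k[q-1] = powerFromW (q ℕ.∸ 1) k-odd z≉0 z-skew (*-cancelˡ z≉0 (begin
      z * (m * z ^ (k ℕ.* (q ℕ.∸ 1)))  ≈⟨ solve 3 (λ z m w → z :* (m :* w) := m :* (z :* w)) refl z m _ ⟩
      m * z ^ (1 ℕ.+ k ℕ.* (q ℕ.∸ 1))  ≡⟨ P.cong (λ n → m * z ^ n) σ≡1+k[q-1] ⟨
      m * S z                          ≈⟨ m*Sz≈z ⟩
      z                                ≈⟨ *-identityʳ z ⟨
      z * 1#                           ∎))

    -- By definition `r * S r` is `r ^ (1 + σ)`, and `1 + σ = k * (q + 1)` with `k` odd.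
    power-plus⇒powerFromW : ∀ {m r} → Skew r → m * (r * S r) ≈ 1# → PowerFromW F q t (q ℕ.+ 1) m
    power-plus⇒powerFromW {m} {r} r-skew m*r*Sr≈1 with odd-quotient-plus q-odd J-odd
    ... | k , k-odd , 1+σ≡k[q+1] = powerFromW (q ℕ.+ 1) k-odd r≉0 r-skew
          (trans (reflexive (P.cong (λ n → m * r ^ n) (P.sym 1+σ≡k[q+1]))) m*r*Sr≈1)
      where
      r≉0 : r ≉ 0#
      r≉0 r≈0 = 1≉0 (trans (sym m*r*Sr≈1) (trans (*-congˡ (trans (*-congʳ r≈0) (zeroˡ _))) (zeroʳ m)))

    cross-multiply : ∀ {f g x y} → x ≉ 0# → y ≉ 0# → f * x ⁻¹ ≈ g * y ⁻¹ → f * y ≈ g * x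
    cross-multiply {f} {g} {x} {y} x≉0 y≉0 f/x≈g/y = begin
      f * y                  ≈⟨ *-congʳ (x[x⁻¹y]≈y f x≉0) ⟨
      x * (x ⁻¹ * f) * y     ≈⟨ solve 4 (λ x x⁻¹ f y → x :* (x⁻¹ :* f) :* y := (f :* x⁻¹) :* (x :* y)) refl x (x ⁻¹) f y ⟩
      (f * x ⁻¹) * (x * y)   ≈⟨ *-congʳ f/x≈g/y ⟩
      (g * y ⁻¹) * (x * y)   ≈⟨ solve 4 (λ x y⁻¹ g y → (g :* y⁻¹) :* (x :* y) := y :* (y⁻¹ :* g) :* x) refl x (y ⁻¹) g y ⟩
      y * (y ⁻¹ * g) * x     ≈⟨ *-congʳ (x[x⁻¹y]≈y g y≉0) ⟩
      g * x                  ∎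

    scattered : ∀ m → Symmetric m → ¬ PowerFromW F q t (q ℕ.∸ 1) m → ¬ PowerFromW F q t (q ℕ.+ 1) m →
      Scattered F q (φ F σ t m)
    scattered m m-sym ¬minus ¬plus x y x≉0 y≉0 φx/x≈φy/y
      with outcome m≉0 y≉0 m-sym
        (symmetricPart-symmetric x) (symmetricPart-symmetric y) (skewPart-skew x) (skewPart-skew y)
        (2x≈S[symmetric]+skew x) (2x≈S[symmetric]+skew y)
        (trans (*-congʳ (sym (φ-decomposition m x)))
          (trans (cross-multiply x≉0 y≉0 φx/x≈φy/y) (*-congʳ (φ-decomposition m y))))
      where
      m≉0 : m ≉ 0#
      m≉0 m≈0 = ¬plus (P.subst (λ e → PowerFromW F q t e m) (ℕ.+-comm 1 q) (zero-powerFromW q m≈0))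
    ... | power-minus z z-skew z≉0 m*Sz≈z = contradiction (power-minus⇒powerFromW z-skew z≉0 m*Sz≈z) ¬minus
    ... | power-plus r r-skew m*r*Sr≈1    = contradiction (power-plus⇒powerFromW r-skew m*r*Sr≈1) ¬plus
    ... | fixed-ratio l Sl≈l x≈ly = begin
      (x * y ⁻¹) ^ q  ≈⟨ ^-congˡ q x/y≈l ⟩
      -- The ratio is fixed by the powers `q ^ J` and `q ^ (2 * t)`, whose exponents `J` and `2 * t`
      -- are coprime.
      l ^ q           ≈⟨ fixed-coprime q J (2 ℕ.* t) gcd≡1 Sl≈l (x^N≈x l) ⟩
      l               ≈⟨ x/y≈l ⟨
      x * y ⁻¹        ∎
      where
      x/y≈l : x * y ⁻¹ ≈ l
      x/y≈l = begin
        x * y ⁻¹        ≈⟨ *-congʳ x≈ly ⟩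
        l * y * y ⁻¹    ≈⟨ *-assoc l y _ ⟩
        l * (y * y ⁻¹)  ≈⟨ *-congˡ (inverseʳ y y≉0) ⟩
        l * 1#          ≈⟨ *-identityʳ l ⟩
        l               ∎

-- Specialization to an odd prime power `q`.

open import Data.Nat using (_^_; _*_; _∸_; _≤_; _+_)

theorem2p3 : (q t J : ℕ) → OddPrimePower q → 3 ≤ t →
    1 ≤ J → J ≤ 2 * t ∸ 1 → gcd J (2 * t) ≡ 1 →
    (F : FiniteField (q ^ (2 * t))) →
    (m : FiniteField.Carrier F) →
    FiniteField._≈_ F (FiniteField._^_ F m (q ^ t)) m →
    ¬ PowerFromW F q t (q ∸ 1) m →
    ¬ PowerFromW F q t (q + 1) m →
    Scattered F q (φ F (q ^ J) t m)
theorem2p3 q t J q-opp@(p , k , p-prime , p≢2 , _ , q≡p^k) 3≤t _ _ gcd≡1 F =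
  QuadrinomialScattered.scattered q t J
    (oddPrimePower⇒odd q-opp) (coprime-even⇒odd t gcd≡1) (ℕ.≤-trans (s≤s z≤n) 3≤t) gcd≡1 F
    (odd·1≈0⇒1+1≉0 (oddPrime⇒odd p-prime p≢2) char-p)
    (λ n → P.subst (λ e → IsRingHomomorphism rawRing rawRing (_^ᶠ e)) (P.sym (q^n≡p^kn n))
      (^[p^n]-isRingHomomorphism p-prime char-p (k * n)))
  where
  open FiniteField F using (rawRing) renaming (_^_ to _^ᶠ_)
  open FieldProperties F

  -- Exhibits the `q ^ n`-th power map as an iterate of the `p`-th power map and, for `n = 2 * t`,
  -- the order of the field as a power of `p`.
  q^n≡p^kn : ∀ n → q ^ n ≡ p ^ (k * n)
  q^n≡p^kn n = P.trans (P.cong (_^ n) q≡p^k) (ℕ.^-*-assoc p k n)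

  char-p = p·1≈0 (k * (2 * t)) (q^n≡p^kn (2 * t))
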